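{- Let $1\le d<\omega$, $2\le k<\omega$, and let $P$ be a $d$-dimensional $k$-template. Then $\chi(L(\mathbb R^d,P))$ is the least cardinal $\kappa$ such that $\kappa^{+(e(P)-1)} \geq 2^{\aleph_0}$.
   Context: A $d$-dimensional $k$-template is a set $P$ of $d$-tuples with $|P|=k$. If $P,Q$ are $d$-dimensional templates, $Q$ is a homomorphic image of $P$ if there is a surjection $f:P\to Q$ such that for all $x,y\in P$ and $i<d$, $x_i=y_i$ implies $f(x)_i=f(y)_i$. For $X=X_0\times\cdots\times X_{d-1}$, $L(X,P)$ is the $k$-hypergraph with vertex set $X$ whose edges are the $k$-templates $Q\subseteq X$ that are homomorphic images of $P$. $\chi$ denotes chromatic number: the least cardinal number of colors in a coloring of the vertices that is not constant on any edge. A set $I\subseteq d=\{0,\dots,d-1\}$ is a distinguisher for $P$ if for all distinct $x,y\in P$ there is $i\in I$ with $x_i\ne y_i$; $e(P)$ is the least cardinality of a distinguisher for $P$. For a cardinal $\kappa$, $\kappa^+$ is its successor cardinal, and $\kappa^{+0}=\kappa$, $\kappa^{+(n+1)}=(\kappa^{+n})^+$. -}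

module Defs where

open import Axiom.ExcludedMiddle using (ExcludedMiddle)
open import Axiom.Extensionality.Propositional using (Extensionality)
open import Data.Bool.Base using (Bool; T)
open import Data.Fin.Base using (Fin)
open import Data.Fin.Subset using (Subset; ∣_∣) renaming (_∈_ to _∈ₛ_)
open import Data.Nat.Base using (ℕ; zero; suc) renaming (_≤_ to _≤ℕ_)
open import Data.Product.Base using (Σ; Σ-syntax; ∃; ∃-syntax; _×_; proj₁)
open import Data.Rational.Base using (ℚ; _<_)
open import Function.Bundles using (_⇔_; _↣_; _↔_)
open import Function.Definitions using (Injective)
open import Level using (Level; Lift; _⊔_; Setω; 0ℓ) renaming (suc to lsuc)
open import Relation.Binary.PropositionalEquality.Core using (_≡_; _≢_)
open import Relation.Nullary.Negation.Core using (¬_)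
open import Relation.Unary using (Pred; _∈_)

private
  variable
    a x y p q v : Level

-- The ambient logic.  `ExcludedMiddle` decides every type, not just every
-- proposition, so together with function extensionality it yields a choice
-- function on the subsets (Bool-valued predicates) of any set, i.e. the axiom
-- of choice.

record Classical : Setω where
  field
    em     : ∀ {ℓ} → ExcludedMiddle ℓ
    funext : ∀ {a b} → Extensionality a b

-- Real numbers as Dedekind cuts, given by their lower sets.  Classically every
-- subset of ℚ has a Bool-valued characteristic function.  The properties are
-- irrelevant, so (with function extensionality) `_≡_` on ℝ is equality of cuts.

record ℝ : Set where
  constructor mkℝ
  field
    below      : ℚ → Bool
    .inhabited : ∃[ r ] T (below r)
    .proper    : ∃[ r ] ¬ T (below r)
    .downward  : ∀ {r s} → r < s → T (below s) → T (below r)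
    .open-up   : ∀ {r} → T (below r) → ∃[ s ] (r < s × T (below s))

Tuple : ∀ {d} → (Fin d → Set x) → Set x
Tuple X = ∀ i → X i

-- The enumeration is into A rather than into Σ A P, so that elements of P are
-- not counted once per proof of membership.

HasSize : {A : Set a} → Pred A p → ℕ → Set (a ⊔ p)
HasSize {A = A} P k =
  Σ[ enum ∈ (Fin k → A) ]
    (Injective _≡_ _≡_ enum × (∀ z → z ∈ P ⇔ (∃[ j ] enum j ≡ z)))

record Template {d} (Y : Fin d → Set y) (k : ℕ) (p : Level) : Set (y ⊔ lsuc p) where
  field
    points : Pred (Tuple Y) p
    size   : HasSize points k

open Template public

-- The condition on f, applied to all i at once
-- to two copies of the same tuple, makes f independent of membership proofs.

HomomorphicImage : ∀ {d} {Y : Fin d → Set y} {X : Fin d → Set x} →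
                   Pred (Tuple Y) p → Pred (Tuple X) q → Set (x ⊔ y ⊔ p ⊔ q)
HomomorphicImage P Q =
  Σ[ f ∈ (Σ _ P → Σ _ Q) ]
    ((∀ t → t ∈ Q → ∃[ s ] proj₁ (f s) ≡ t) ×
     (∀ s t i → proj₁ s i ≡ proj₁ t i → proj₁ (f s) i ≡ proj₁ (f t) i))

record Hypergraph (k : ℕ) (v q : Level) : Set (lsuc (v ⊔ q)) where
  field
    Vertex    : Set v
    Edge      : Pred (Pred Vertex v) q
    edge-size : ∀ Q → Edge Q → HasSize Q k

L : ∀ {d k} {Y : Fin d → Set y} (X : Fin d → Set x) →
    Template Y k p → Hypergraph k x (x ⊔ y ⊔ p)
L {k = k} X P = record
  { Vertex    = Tuple X
  ; Edge      = λ Q → HasSize Q k × HomomorphicImage (points P) Q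
  ; edge-size = λ _ → proj₁
  }

IsDistinguisher : ∀ {d k} {Y : Fin d → Set y} → Template Y k p → Subset d → Set (y ⊔ p)
IsDistinguisher P I =
  ∀ s t → s ∈ points P → t ∈ points P → s ≢ t → ∃[ i ] (i ∈ₛ I × s i ≢ t i)

-- `Isₑ P n` says that e(P) = n.

Isₑ : ∀ {d k} {Y : Fin d → Set y} → Template Y k p → ℕ → Set (y ⊔ p)
Isₑ P n = (∃[ I ] (IsDistinguisher P I × ∣ I ∣ ≡ n)) ×
          (∀ I → IsDistinguisher P I → n ≤ℕ ∣ I ∣)

-- Cardinals are represented by sets, which stand for the same cardinal when
-- they are in bijection; the order is existence of an injection.

Cardinal : Set₁
Cardinal = Set

_≼_ : Cardinal → Cardinal → Set
κ ≼ μ = κ ↣ μ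

_≺_ : Cardinal → Cardinal → Set
κ ≺ μ = κ ≼ μ × ¬ (μ ≼ κ)

IsLeast : (Cardinal → Set q) → Cardinal → Set (lsuc 0ℓ ⊔ q)
IsLeast Φ κ = Φ κ × (∀ μ → Φ μ → κ ≼ μ)

-- `IsSuccessor κ μ` says that μ = κ⁺, and `IsIteratedSuccessor n κ μ` says
-- that μ = κ⁺ⁿ.

IsSuccessor : Cardinal → Cardinal → Set₁
IsSuccessor κ = IsLeast (κ ≺_)

IsIteratedSuccessor : ℕ → Cardinal → Cardinal → Set₁
IsIteratedSuccessor zero    κ μ = Lift (lsuc 0ℓ) (κ ↔ μ)
IsIteratedSuccessor (suc n) κ μ =
  Σ[ ν ∈ Cardinal ] (IsIteratedSuccessor n κ ν × IsSuccessor ν μ)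

2^ℵ₀ : Cardinal
2^ℵ₀ = ℕ → Bool

ReachesContinuum : ℕ → Cardinal → Set₁
ReachesContinuum n κ = Σ[ μ ∈ Cardinal ] (IsIteratedSuccessor n κ μ × (2^ℵ₀ ≼ μ))

module _ {k} (H : Hypergraph k v q) where
  open Hypergraph H

  IsProperColoring : {C : Cardinal} → (Vertex → C) → Set (lsuc v ⊔ q)
  IsProperColoring c = ∀ Q → Edge Q → ¬ (∀ s t → s ∈ Q → t ∈ Q → c s ≡ c t)

  Colorable : Cardinal → Set (lsuc v ⊔ q)
  Colorable C = Σ[ c ∈ (Vertex → C) ] IsProperColoring c

  -- `IsChromaticNumber κ` says that χ(H) = κ.

  IsChromaticNumber : Cardinal → Set (lsuc (0ℓ ⊔ v) ⊔ q)
  IsChromaticNumber = IsLeast Colorable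

-- Write e(P) = m + 1.  If |X| ≤ κ⁺ᵐ with κ infinite, the points of Xᵈ can be
-- coloured with κ colours so that each colour comes with m coordinates which
-- determine the points of that colour: well-order X so that every initial
-- segment has size at most κ⁺⁽ᵐ⁻¹⁾, record the position of the largest
-- coordinate, and recurse inside the initial segment that it bounds.  As m
-- coordinates never distinguish the points of P, no image of P is monochromatic.
-- Conversely, if κ⁺ᵐ < 2^ℵ₀ then, κ being infinite, κ⁺⁽ᵐ⁺¹⁾ ≤ 2^ℵ₀, and m + 1
-- applications of the pigeonhole principle give, for any colouring of ℝᵐ⁺¹ with
-- κ colours, a monochromatic box with sides of size k.  (For finite κ, boxes in
-- powers of finite sets suffice.)  Placed along the coordinates of a minimal
-- distinguisher, the box contains an image of P.  The set theory behind this is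
-- Zermelo's theorem, proved with the tower of subsets generated from a choice
-- function, comparability of cardinals, and A × A ≼ A for infinite A.
module Submission where

open import Data.Bool.Base using (Bool; true; false; T)
open import Data.Empty using (⊥; ⊥-elim)
open import Data.Fin.Base using (Fin; combine; funToFin; finToFun; fromℕ<; punchOut; _↑ʳ_)
open import Data.Fin.Properties using
  (toℕ-injective; injective⇒≤; fromℕ<-injective; combine-injective; finToFun-funToFin;
   punchOut-injective; ↑ʳ-injective; ¬Fin0; 0≢1+n)
open import Data.Fin.Subset using (Subset; ∣_∣; ⁅_⁆; _∪_; inside; outside) renaming (_∈_ to _∈ₛ_)
import Data.Fin.Subset as Subset
open import Data.Fin.Subset.Properties using (∣⊥∣≡0; ∣⁅x⁆∣≡1; x∈p∪q⁺; x∈⁅x⁆; ∈⊤)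
open import Data.Integer.Base using (ℤ; +_; -[1+_])
open import Data.Irrelevant using ([_])
open import Data.Maybe.Base using (Maybe; just; nothing)
open import Data.Maybe.Properties using (just-injective; map-injective)
open import Data.Nat.Base using (ℕ; zero; suc; _≤_; _∸_)
import Data.Nat.Base as ℕ
open import Data.Nat.Induction using (<-wellFounded)
import Data.Nat.Properties as ℕ
open import Data.Product.Base using (Σ; Σ-syntax; ∃; ∃-syntax; _×_; _,_; proj₁; proj₂)
open import Data.Product.Relation.Binary.Lex.Strict using (×-Lex; ×-wellFounded)
open import Data.Rational.Base using (ℚ; mkℚ; 0ℚ; 1ℚ; -½)
import Data.Rational.Base as ℚ
import Data.Rational.Properties as ℚ
open import Data.Refinement.Base using (Refinement; value; _,_)
open import Data.Sum.Base using (_⊎_; inj₁; inj₂)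
open import Data.Vec.Base using ([]; _∷_; here; there)
open import Defs
open import Function.Base using (_∘_; id)
open import Function.Bundles using (mk↣; mk⇔; Injection; Equivalence)
open import Function.Construct.Composition using () renaming (_↣-∘_ to infixr 8 _⊙_)
open import Function.Construct.Identity using (↣-id; ↔-id)
open import Function.Definitions using (Injective)
open import Function.Properties.Inverse using (↔⇒↣; ↔-sym)
open import Induction.WellFounded using (WellFounded; WfRec; Acc; acc; wf⇒asym; module All; module FixPoint)
open import Level using (Level; 0ℓ; lift)
import Relation.Binary.Construct.On as On
open import Relation.Binary.Definitions using (Tri; tri<; tri≈; tri>)
open import Relation.Binary.PropositionalEquality
open import Relation.Nullary using (¬_; Dec; yes; no; contradiction)
open import Relation.Nullary.Decidable using (⌊_⌋; toWitness; fromWitness; decidable-stable; recompute)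
open import Relation.Unary using (Pred)

open Injection using (to; injective)

private
  variable
    A B C D : Set

-- Well-orders and their initial segments.

record WellOrder (A : Set) : Set₁ where
  field
    _<_ : A → A → Set
    wf  : WellFounded _<_
    tri : ∀ a b → a < b ⊎ (a ≡ b ⊎ b < a)

  asym : ∀ {a b} → a < b → ¬ (b < a)
  asym = wf⇒asym wf

  -- A cycle c < a < b < c would give c < b, by transitivity from the smaller point c, against b <
  -- c.
  trans< : ∀ {a b c} → a < b → b < c → a < c
  trans< = go (wf _)
    where
    go : ∀ {a b c} → Acc _<_ a → a < b → b < c → a < c
    go {a} {b} {c} (acc rs) p q with tri a c
    ... | inj₁ r           = r
    ... | inj₂ (inj₁ refl) = contradiction q (asym p)
    ... | inj₂ (inj₂ r)    = contradiction p (asym (go (rs r) r p) ∘ λ _ → q)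

  -- The bound is irrelevant, so that elements are equal when their values are; `recompute em`
  -- restores it where it is needed.
  Below : A → Set
  Below a = Refinement A (_< a)

T-antisym : ∀ {x y} → (T x → T y) → (T y → T x) → x ≡ y
T-antisym {false} {false} f g = refl
T-antisym {false} {true}  f g = ⊥-elim (g _)
T-antisym {true}  {false} f g = ⊥-elim (f _)
T-antisym {true}  {true}  f g = refl

value-inj : ∀ {P : A → Set} {x y : Refinement A P} → value x ≡ value y → x ≡ y
value-inj refl = refl

Below≼ : (o : WellOrder A) → ∀ a → WellOrder.Below o a ≼ A
Below≼ o a = mk↣ value-inj

pullback : A ≼ B → WellOrder B → WellOrder A
pullback r o = record
  { _<_ = λ x y → to r x < to r y
  ; wf  = On.wellFounded (to r) wf
  ; tri = λ x y → tri′ x y (tri (to r x) (to r y))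
  }
  where
  open WellOrder o
  tri′ : ∀ x y → _ → _
  tri′ x y (inj₁ p)        = inj₁ p
  tri′ x y (inj₂ (inj₁ p)) = inj₂ (inj₁ (injective r p))
  tri′ x y (inj₂ (inj₂ p)) = inj₂ (inj₂ p)

pullback-Below≼ : (r : A ≼ B) (o : WellOrder B) → ∀ a →
                  WellOrder.Below (pullback r o) a ≼ WellOrder.Below o (to r a)
pullback-Below≼ r o a = mk↣ {to = λ (b , p) → to r b , p}
  λ eq → value-inj (injective r (cong value eq))

-- Finite sets and products.

Finite : Set → Set
Finite A = ∃[ n ] (A ≼ Fin n)

Fin⋠Fin : ∀ {m n} → n ℕ.< m → ¬ (Fin m ≼ Fin n)
Fin⋠Fin n<m f = ℕ.<⇒≱ n<m (injective⇒≤ (injective f))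

Fin≼ℕ : ∀ {n} → Fin n ≼ ℕ
Fin≼ℕ = mk↣ toℕ-injective

ℕ⋠Finite : Finite A → ¬ (ℕ ≼ A)
ℕ⋠Finite (n , f) e = Fin⋠Fin (ℕ.n<1+n n) (f ⊙ e ⊙ Fin≼ℕ)

ℕ-wellOrder : WellOrder ℕ
ℕ-wellOrder = record { _<_ = ℕ._<_ ; wf = <-wellFounded ; tri = λ a b → go (ℕ.<-cmp a b) }
  where
  go : ∀ {a b} → Tri (a ℕ.< b) (a ≡ b) (b ℕ.< a) → a ℕ.< b ⊎ (a ≡ b ⊎ b ℕ.< a)
  go (tri< p _ _) = inj₁ p
  go (tri≈ _ p _) = inj₂ (inj₁ p)
  go (tri> _ _ p) = inj₂ (inj₂ p)

×-≼ : A ≼ B → C ≼ D → (A × C) ≼ (B × D)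
×-≼ f g = mk↣ {to = λ (a , c) → to f a , to g c} λ eq →
  cong₂ _,_ (injective f (cong proj₁ eq)) (injective g (cong proj₂ eq))

Maybe-≼ : A ≼ B → Maybe A ≼ Maybe B
Maybe-≼ f = mk↣ (map-injective (injective f))

Finite-≼ : A ≼ B → Finite B → Finite A
Finite-≼ f (n , g) = n , g ⊙ f

Fin-Finite : ∀ n → Finite (Fin n)
Fin-Finite n = n , ↣-id _

×-Finite : Finite A → Finite B → Finite (A × B)
×-Finite (m , f) (n , g) = m ℕ.* n ,
  mk↣ {to = λ (i , j) → combine i j} (λ eq →
    let p , q = combine-injective _ _ _ _ eq in cong₂ _,_ p q) ⊙ ×-≼ f g

Maybe-Finite : Finite A → Finite (Maybe A)
Maybe-Finite (n , f) = suc n , mk↣ {to = code} (λ {x} {y} → code-inj x y) ⊙ Maybe-≼ f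
  where
  code : Maybe (Fin n) → Fin (suc n)
  code (just i) = Fin.suc i
  code nothing  = Fin.zero
  code-inj : ∀ x y → code x ≡ code y → x ≡ y
  code-inj (just i) (just .i) refl = refl
  code-inj nothing  nothing   refl = refl

lex : WellOrder A → WellOrder B → WellOrder (A × B)
lex o p = record
  { _<_ = ×-Lex _≡_ O._<_ P._<_
  ; wf  = ×-wellFounded O.wf P.wf
  ; tri = lex-tri
  }
  where
  module O = WellOrder o
  module P = WellOrder p
  lex-tri : ∀ x y → _
  lex-tri (a , b) (c , d) with O.tri a c | P.tri b d
  ... | inj₁ q           | _                = inj₁ (inj₁ q)
  ... | inj₂ (inj₂ q)    | _                = inj₂ (inj₂ (inj₁ q))
  ... | inj₂ (inj₁ refl) | inj₁ q           = inj₁ (inj₂ (refl , q))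
  ... | inj₂ (inj₁ refl) | inj₂ (inj₁ refl) = inj₂ (inj₁ refl)
  ... | inj₂ (inj₁ refl) | inj₂ (inj₂ q)    = inj₂ (inj₂ (inj₂ (refl , q)))

Square : Set → Set
Square A = (A × A) ≼ A

-- Binary sequences as nested rational intervals.

record Interval : Set where
  field
    lo hi : ℚ
    lo<hi : lo ℚ.< hi

open Interval

-- The two halves are separated by a gap, so that binary sequences have
-- distinct limits.
refineWithin : Bool → Interval → Interval
refineWithin false I = let m , p , _ = ℚ.<-dense (lo<hi I) in
  record { lo = lo I ; hi = m ; lo<hi = p }
refineWithin true I = let _ , _ , q = ℚ.<-dense (lo<hi I) ; m′ , _ , r = ℚ.<-dense q in
  record { lo = m′ ; hi = hi I ; lo<hi = r }

lower : (ℕ → Bool) → Interval → ℕ → ℚ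
lower s I zero    = lo I
lower s I (suc n) = lower (s ∘ suc) (refineWithin (s 0) I) n

lo-refine : ∀ b I {q} → q ℚ.< lo I → q ℚ.< lo (refineWithin b I)
lo-refine false I q< = q<
lo-refine true  I q< = let _ , p , q = ℚ.<-dense (lo<hi I) ; _ , r , _ = ℚ.<-dense q in
  ℚ.<-trans q< (ℚ.<-trans p r)

hi-refine : ∀ b I {q} → q ℚ.< hi (refineWithin b I) → q ℚ.< hi I
hi-refine false I q< = let _ , _ , q = ℚ.<-dense (lo<hi I) in ℚ.<-trans q< q
hi-refine true  I q< = q<

lower<hi : ∀ s I n → lower s I n ℚ.< hi I
lower<hi s I zero    = lo<hi I
lower<hi s I (suc n) = hi-refine (s 0) I (lower<hi (s ∘ suc) _ n)

BelowLimit : (ℕ → Bool) → Interval → ℚ → Set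
BelowLimit s I q = ∃[ n ] q ℚ.< lower s I n

tail-limit : ∀ s I {q} → BelowLimit s I q → BelowLimit (s ∘ suc) (refineWithin (s 0) I) q
tail-limit s I (zero  , p) = 0 , lo-refine (s 0) I p
tail-limit s I (suc n , p) = n , p

-- The dividing point m exceeds every left end of a sequence that starts with `false`, while the gap
-- puts m below the left end that `true` chooses.
midpoint-separates : ∀ {s t} I → (∀ q → BelowLimit t I q → BelowLimit s I q) →
                     s 0 ≡ false → t 0 ≢ true
midpoint-separates {s} {t} I h s0 t0 =
  ℚ.<-asym (proj₂ m<s) (subst (λ b → lower (s ∘ suc) (refineWithin b I) (proj₁ m<s) ℚ.< m) (sym s0)
    (lower<hi (s ∘ suc) (refineWithin false I) (proj₁ m<s)))
  where
  m = proj₁ (ℚ.<-dense (lo<hi I))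
  m<t : BelowLimit t I m
  m<t = 1 , subst (λ b → m ℚ.< lo (refineWithin b I)) (sym t0)
              (proj₁ (proj₂ (ℚ.<-dense (proj₂ (proj₂ (ℚ.<-dense (lo<hi I)))))))
  m<s : BelowLimit (s ∘ suc) (refineWithin (s 0) I) m
  m<s = tail-limit s I (h m m<t)

-- The first terms agree, since otherwise m would separate the limits; the tails then refine the
-- same interval.
limit-injective : ∀ n {s t} I → (∀ q → BelowLimit s I q → BelowLimit t I q) →
                  (∀ q → BelowLimit t I q → BelowLimit s I q) → s n ≡ t n
limit-injective zero {s} {t} I f g = go (s 0) (t 0) refl refl
  where
  go : ∀ b c → s 0 ≡ b → t 0 ≡ c → s 0 ≡ t 0
  go false true  p q = contradiction q (midpoint-separates I g p)
  go true  false p q = contradiction p (midpoint-separates I f q)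
  go false false p q = trans p (sym q)
  go true  true  p q = trans p (sym q)
limit-injective (suc n) {s} {t} I f g = limit-injective n {s ∘ suc} {t ∘ suc} (refineWithin (s 0) I)
  (λ q (m , p) → subst (λ b → BelowLimit (t ∘ suc) (refineWithin b I) q) (sym s0≡t0) (tail-limit t I (f q (suc m , p))))
  (λ q (m , p) → tail-limit s I (g q (suc m , subst (λ b → q ℚ.< lower (t ∘ suc) (refineWithin b I) m) s0≡t0 p)))
  where
  s0≡t0 = limit-injective zero {s} {t} I f g

-- Iterated successors, sets of coordinates and boxes.

iteratedSuccessor-≽ : ∀ n {κ μ} → IsIteratedSuccessor n κ μ → κ ≼ μ
iteratedSuccessor-≽ zero    (lift e)                = ↔⇒↣ e
iteratedSuccessor-≽ (suc n) (ν , p , (ν≼μ , _) , _) = ν≼μ ⊙ iteratedSuccessor-≽ n p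

∣p∪q∣≤∣p∣+∣q∣ : ∀ {n} (p q : Subset n) → ∣ p ∪ q ∣ ≤ ∣ p ∣ ℕ.+ ∣ q ∣
∣p∪q∣≤∣p∣+∣q∣ []            []            = ℕ.z≤n
∣p∪q∣≤∣p∣+∣q∣ (outside ∷ p) (outside ∷ q) = ∣p∪q∣≤∣p∣+∣q∣ p q
∣p∪q∣≤∣p∣+∣q∣ (outside ∷ p) (inside ∷ q)  rewrite ℕ.+-suc ∣ p ∣ ∣ q ∣ = ℕ.s≤s (∣p∪q∣≤∣p∣+∣q∣ p q)
∣p∪q∣≤∣p∣+∣q∣ (inside ∷ p)  (outside ∷ q) = ℕ.s≤s (∣p∪q∣≤∣p∣+∣q∣ p q)
∣p∪q∣≤∣p∣+∣q∣ (inside ∷ p)  (inside ∷ q)  =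
  ℕ.s≤s (ℕ.≤-trans (∣p∪q∣≤∣p∣+∣q∣ p q) (ℕ.+-monoʳ-≤ ∣ p ∣ (ℕ.n≤1+n ∣ q ∣)))

-- Turns the m coordinates selected by a colour into a candidate distinguisher; repetitions only
-- make it smaller.
range : ∀ {m n} (f : Fin m → Fin n) → ∃[ S ] (∣ S ∣ ≤ m × ∀ i → f i ∈ₛ S)
range {zero}  {n} f = Subset.⊥ , ℕ.≤-reflexive (∣⊥∣≡0 n) , λ ()
range {suc m} f with range (f ∘ Fin.suc)
... | S , ∣S∣≤ , f∈ = ⁅ f Fin.zero ⁆ ∪ S
  , ℕ.≤-trans (∣p∪q∣≤∣p∣+∣q∣ ⁅ f Fin.zero ⁆ S) (ℕ.+-mono-≤ (ℕ.≤-reflexive (∣⁅x⁆∣≡1 (f Fin.zero))) ∣S∣≤)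
  , λ { Fin.zero → x∈p∪q⁺ (inj₁ (x∈⁅x⁆ _)) ; (Fin.suc i) → x∈p∪q⁺ (inj₂ (f∈ i)) }

-- The polarized partition relation with n equal factors. The sides are enumerated, so that points
-- of the box are given by index tuples.
HasBoxes : ℕ → ℕ → Set → Set → Set
HasBoxes k n K X = (f : (Fin n → X) → K) →
  Σ[ B ∈ (Fin n → Fin k → X) ]
    ((∀ i → Injective _≡_ _≡_ (B i)) ×
     (∀ (g h : Fin n → Fin k) → f (λ i → B i (g i)) ≡ f (λ i → B i (h i))))

HasBoxes-mono : ∀ {k n K X Y} → X ≼ Y → HasBoxes k n K X → HasBoxes k n K Y
HasBoxes-mono e box f =
  let B , inj , mono = box (λ x → f (to e ∘ x))
  in (λ i → to e ∘ B i) , (λ i → inj i ∘ injective e) , mono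

infixr 5 _◂_
_◂_ : ∀ {n} → A → (Fin n → A) → Fin (suc n) → A
(a ◂ x) Fin.zero    = a
(a ◂ x) (Fin.suc i) = x i

-- Attaches the axes of a box to the coordinates in a distinguisher.
enumerate : ∀ {n} (I : Subset n) → ∃[ e ] ∀ {i} → i ∈ₛ I → ∃[ j ] e j ≡ i
enumerate {n} I = go I
  where
  Enumeration : ∀ {n} → Subset n → Set
  Enumeration {n} I = Σ[ e ∈ (Fin ∣ I ∣ → Fin n) ] (∀ {i} → i ∈ₛ I → ∃[ j ] e j ≡ i)
  go : ∀ {n} (I : Subset n) → Enumeration I
  go []            = (λ ()) , λ ()
  go (outside ∷ I) = let e , c = go I in Fin.suc ∘ e , λ { (there p) → let j , q = c p in j , cong Fin.suc q }
  go (inside ∷ I)  = let e , c = go I in (Fin.zero ◂ Fin.suc ∘ e) , λ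
    { here      → Fin.zero , refl
    ; (there p) → let j , q = c p in Fin.suc j , cong Fin.suc q }

-- Classical logic.

module _ (cl : Classical) where
  open Classical cl

  dec : ∀ {ℓ} (P : Set ℓ) → Dec P
  dec P = em

  byContradiction : ∀ {ℓ} {P : Set ℓ} → ¬ ¬ P → P
  byContradiction = decidable-stable em

  ¬∀⇒∃¬ : ∀ {a p} {A : Set a} {P : A → Set p} → ¬ (∀ x → P x) → ∃[ x ] ¬ P x
  ¬∀⇒∃¬ h = byContradiction λ none → h λ x → byContradiction λ ¬p → none (x , ¬p)

  ⟦_⟧ : Set → Bool
  ⟦ P ⟧ = ⌊ dec P ⌋

  -- Zermelo's theorem.

  module Zermelo (A : Set) where

    _∈_ : A → (A → Bool) → Set
    a ∈ U = T (U a)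

    _⊆_ : (A → Bool) → (A → Bool) → Set
    U ⊆ V = ∀ a → a ∈ U → a ∈ V

    ⊆-antisym : ∀ {U V} → U ⊆ V → V ⊆ U → U ≡ V
    ⊆-antisym p q = funext λ a → T-antisym (p a) (q a)

    -- The witness returned by excluded middle is fixed, and so serves as a choice function. The
    -- decision is an argument so that lemmas can split on it.
    Chosen′ : ∀ {U} → Dec (∃[ a ] ¬ (a ∈ U)) → A → Set
    Chosen′ (yes (b , _)) a = a ≡ b
    Chosen′ (no _)        a = ⊥

    Chosen : (A → Bool) → A → Set
    Chosen U = Chosen′ {U} em

    Chosen-unique : ∀ U {a b} → Chosen U a → Chosen U b → a ≡ b
    Chosen-unique U = go em
      where
      go : ∀ d {a b} → Chosen′ {U} d a → Chosen′ {U} d b → a ≡ b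
      go (yes _) p q = trans p (sym q)

    Chosen-∃ : ∀ U {a} → ¬ (a ∈ U) → ∃[ b ] (¬ (b ∈ U) × Chosen U b)
    Chosen-∃ U {a} a∉U = go em
      where
      go : ∀ d → ∃[ b ] (¬ (b ∈ U) × Chosen′ {U} d b)
      go (yes (b , b∉U)) = b , b∉U , refl
      go (no none)       = ⊥-elim (none (a , a∉U))

    adjoin : (A → Bool) → (A → Bool)
    adjoin U a = ⟦ a ∈ U ⊎ Chosen U a ⟧

    ⋃ : ((A → Bool) → Bool) → (A → Bool)
    ⋃ F a = ⟦ ∃[ U ] (T (F U) × a ∈ U) ⟧

    -- The union of the empty family is the starting point of the tower.
    data Tower : (A → Bool) → Set where
      next  : ∀ {U} → Tower U → Tower (adjoin U)
      union : ∀ F → (∀ {U} → T (F U) → Tower U) → Tower (⋃ F)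

    ⊆adjoin : ∀ U → U ⊆ adjoin U
    ⊆adjoin U a = fromWitness ∘ inj₁

    Comparable : (A → Bool) → Set
    Comparable U = ∀ {V} → Tower V → U ⊆ V ⊎ V ⊆ U

    -- No member of the tower lies strictly between a comparable U and `adjoin U`; induction on how
    -- V is generated.
    adjoin-comparable : ∀ {U} → Comparable U → ∀ {V} → Tower V → adjoin U ⊆ V ⊎ V ⊆ U
    adjoin-comparable {U} c (next {V} t) with adjoin-comparable c t | c (next t)
    ... | inj₁ p | _      = inj₁ λ a → ⊆adjoin V a ∘ p a
    ... | inj₂ _ | inj₂ q = inj₂ q
    ... | inj₂ p | inj₁ q with dec (U ⊆ V)
    ...   | yes r = inj₁ (subst (λ W → adjoin U ⊆ adjoin W) (⊆-antisym r p) λ a → id)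
    ...   | no ¬r = inj₂ absorb
      where
      -- A point z of U outside V lies in `adjoin V`, so it is the point chosen for V, and adjoining
      -- it stays inside U.
      absorb : adjoin V ⊆ U
      absorb a a∈ with ¬∀⇒∃¬ ¬r
      ... | z , h with dec (z ∈ U)
      ...   | no z∉U = contradiction (λ z∈U → contradiction z∈U z∉U) h
      ...   | yes z∈U with toWitness (q z z∈U) | toWitness a∈
      ...     | inj₁ z∈V | _         = contradiction (λ _ → z∈V) h
      ...     | inj₂ _   | inj₁ a∈V  = p a a∈V
      ...     | inj₂ cz  | inj₂ ca   = subst (_∈ U) (Chosen-unique V cz ca) z∈U
    adjoin-comparable {U} c (union F f) with dec (∃[ V ] (T (F V) × adjoin U ⊆ V))
    ... | yes (V , FV , p) = inj₁ λ a a∈ → fromWitness (V , FV , p a a∈)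
    ... | no none = inj₂ λ a a∈ → below a (toWitness a∈)
      where
      below : ∀ a → ∃[ V ] (T (F V) × a ∈ V) → a ∈ U
      below a (V , FV , a∈V) with adjoin-comparable c (f FV)
      ... | inj₁ p = contradiction (V , FV , p) none
      ... | inj₂ p = p a a∈V

    comparable : ∀ {U} → Tower U → Comparable U
    comparable (next {U} s) t with adjoin-comparable (comparable s) t
    ... | inj₁ p = inj₁ p
    ... | inj₂ p = inj₂ λ a → ⊆adjoin U a ∘ p a
    comparable (union F f) {V} t with dec (∃[ U ] (T (F U) × V ⊆ U))
    ... | yes (U , FU , p) = inj₂ λ a a∈ → fromWitness (U , FU , p a a∈)
    ... | no none = inj₁ λ a a∈ → below a (toWitness a∈)
      where
      below : ∀ a → ∃[ U ] (T (F U) × a ∈ U) → a ∈ V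
      below a (U , FU , a∈U) with comparable (f FU) t
      ... | inj₁ p = p a a∈U
      ... | inj₂ p = contradiction (U , FU , p) none

    avoiding : A → (A → Bool) → Bool
    avoiding a U = ⟦ Tower U × ¬ (a ∈ U) ⟧

    -- The largest member of the tower without a; a is the point chosen next.
    before : A → (A → Bool)
    before a = ⋃ (avoiding a)

    before-tower : ∀ a → Tower (before a)
    before-tower a = union (avoiding a) λ p → proj₁ (toWitness p)

    ∉before : ∀ a → ¬ (a ∈ before a)
    ∉before a p with toWitness p
    ... | U , q , a∈U = proj₂ (toWitness q) a∈U

    before-max : ∀ {a U} → Tower U → ¬ (a ∈ U) → U ⊆ before a
    before-max {U = U} t a∉U b b∈U = fromWitness (U , fromWitness (t , a∉U) , b∈U)

    -- Otherwise `adjoin (before a)` would be a strictly larger member of the tower that avoids a.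
    ∈adjoin-before : ∀ a → a ∈ adjoin (before a)
    ∈adjoin-before a = byContradiction λ a∉ →
      let b , b∉ , cb = Chosen-∃ (before a) (∉before a)
      in b∉ (before-max (next (before-tower a)) a∉ b (fromWitness (inj₂ cb)))

    _<_ : A → A → Set
    a < b = ∃[ U ] (Tower U × a ∈ U × ¬ (b ∈ U))

    -- If neither `before a` nor `adjoin (before a)` separates the two, both are the point chosen
    -- for `before a`.
    <-tri : ∀ a b → a < b ⊎ (a ≡ b ⊎ b < a)
    <-tri a b with dec (b ∈ before a) | dec (b ∈ adjoin (before a))
    ... | yes b∈ | _      = inj₂ (inj₂ (before a , before-tower a , b∈ , ∉before a))
    ... | no _   | no b∉  = inj₁ (_ , next (before-tower a) , ∈adjoin-before a , b∉)
    ... | no b∉  | yes b∈ with toWitness b∈ | toWitness (∈adjoin-before a)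
    ...   | inj₁ b∈′ | _       = contradiction b∈′ b∉
    ...   | inj₂ _   | inj₁ a∈ = contradiction a∈ (∉before a)
    ...   | inj₂ cb  | inj₂ ca = inj₂ (inj₁ (Chosen-unique (before a) ca cb))

    -- A predecessor of a newly adjoined point lies in a member V that misses this point;
    -- comparability gives V ⊆ U, where induction applies.
    members-acc : ∀ {U} → Tower U → ∀ {a} → a ∈ U → Acc _<_ a
    members-acc (next {U} t) {a} a∈ with toWitness a∈ | dec (a ∈ U)
    ... | _        | yes a∈U = members-acc t a∈U
    ... | inj₁ a∈U | no _    = members-acc t a∈U
    ... | inj₂ ca  | no a∉U  = acc smaller
      where
      smaller : ∀ {b} → b < a → Acc _<_ b
      smaller {b} (V , s , b∈V , a∉V) with adjoin-comparable (comparable t) s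
      ... | inj₁ p = contradiction (p a a∈) a∉V
      ... | inj₂ p = members-acc t (p b b∈V)
    members-acc (union F f) a∈ with toWitness a∈
    ... | U , FU , a∈U = members-acc (f FU) a∈U

    abstract
      wellOrder : WellOrder A
      wellOrder = record
        { _<_ = _<_
        ; wf  = λ a → members-acc (next (before-tower a)) (∈adjoin-before a)
        ; tri = <-tri
        }

  open Zermelo using (wellOrder)

  -- Comparability of cardinals.

  module _ {W : Set} (o : WellOrder W) (B : Set) where
    open WellOrder o

    private
      Fresh : ∀ {x} → WfRec _<_ (λ _ → Maybe B) x → B → Set
      Fresh {x} rec b = ∀ {y} (p : y < x) → rec p ≢ just b

      pick : ∀ {x} {rec : WfRec _<_ (λ _ → Maybe B) x} → Dec (∃[ b ] Fresh rec b) → Maybe B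
      pick (yes (b , _)) = just b
      pick (no _)        = nothing

      step : ∀ x → WfRec _<_ (λ _ → Maybe B) x → Maybe B
      step x rec = pick {rec = rec} em

      step-ext : ∀ x {f g : WfRec _<_ (λ _ → Maybe B) x} →
                 (∀ {y} (p : y < x) → f p ≡ g p) → step x f ≡ step x g
      step-ext x {f} {g} eq = helper (λ y → f {y}) (λ y → g {y}) (funext λ y → funext λ p → eq p)
        where
        helper : (f g : ∀ y → y < x → Maybe B) → f ≡ g →
                 step x (λ {y} → f y) ≡ step x (λ {y} → g y)
        helper f .f refl = refl

      -- Enumerates B along W without repetition until B is exhausted.
      g : W → Maybe B
      g = All.wfRec wf 0ℓ (λ _ → Maybe B) step

      g-unfold : ∀ x → g x ≡ step x (λ {y} _ → g y)
      g-unfold x = FixPoint.unfold-wfRec wf (λ _ → Maybe B) step step-ext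

      g-just : ∀ x {b} → g x ≡ just b → ∀ {y} → y < x → g y ≢ just b
      g-just x eq = go em (trans (sym (g-unfold x)) eq)
        where
        go : ∀ d {b} → pick {x} {λ {y} _ → g y} d ≡ just b → ∀ {y} → y < x → g y ≢ just b
        go (yes (_ , fresh)) refl = fresh

      g-nothing : ∀ x → g x ≡ nothing → ∀ b → ∃[ y ] (y < x × g y ≡ just b)
      g-nothing x eq = go em (trans (sym (g-unfold x)) eq)
        where
        go : ∀ d → pick {x} {λ {y} _ → g y} d ≡ nothing → ∀ b → ∃[ y ] (y < x × g y ≡ just b)
        go (no none) _ b = byContradiction λ h → none (b , λ {y} p q → h (y , p , q))

    abstract
      -- If the enumeration `g` runs out at w, all of B has been listed before w; if it never runs
      -- out, it embeds W.
      compare : W ≼ B ⊎ ∃[ w ] (B ≼ Below w)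
      compare with dec (∃[ w ] (g w ≡ nothing))
      ... | yes (w , eq) = inj₂ (w , mk↣ {to = back} back-inj)
        where
        back : B → Below w
        back b = let y , p , _ = g-nothing w eq b in y , [ p ]
        back-inj : Injective _≡_ _≡_ back
        back-inj {b} {c} e = just-injective (trans (sym (proj₂ (proj₂ (g-nothing w eq b))))
          (trans (cong (g ∘ value) e) (proj₂ (proj₂ (g-nothing w eq c)))))
      ... | no none = inj₁ (mk↣ {to = λ w → proj₁ (val w)} val-inj)
        where
        val′ : ∀ w (m : Maybe B) → g w ≡ m → ∃[ b ] (g w ≡ just b)
        val′ w (just b) eq = b , eq
        val′ w nothing  eq = contradiction (w , eq) none
        val : ∀ w → ∃[ b ] (g w ≡ just b)
        val w = val′ w (g w) refl
        val-inj : Injective _≡_ _≡_ (λ w → proj₁ (val w))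
        val-inj {w} {v} eq with tri w v
        ... | inj₁ p        = contradiction (trans (proj₂ (val w)) (cong just eq)) (g-just v (proj₂ (val v)) p)
        ... | inj₂ (inj₁ p) = p
        ... | inj₂ (inj₂ p) = contradiction (trans (proj₂ (val v)) (cong just (sym eq))) (g-just w (proj₂ (val w)) p)

  abstract
    ≼-total : ∀ A B → A ≼ B ⊎ B ≼ A
    ≼-total A B with compare (wellOrder A) B
    ... | inj₁ p       = inj₁ p
    ... | inj₂ (w , p) = inj₂ (Below≼ (wellOrder A) w ⊙ p)

  abstract
    ⋠⇒≽ : ¬ (A ≼ B) → B ≼ A
    ⋠⇒≽ {A} {B} h with ≼-total A B
    ... | inj₁ p = contradiction p h
    ... | inj₂ p = p

  -- Least cardinals and successors.

  minimal : ∀ {q} (o : WellOrder A) {P : A → Set q} → ∃ P →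
            ∃[ a ] (P a × ∀ b → WellOrder._<_ o b a → ¬ P b)
  minimal o {P} (a , p) = go (wf a) p
    where
    open WellOrder o
    go : ∀ {a} → Acc _<_ a → P a → ∃[ a ] (P a × ∀ b → b < a → ¬ P b)
    go {a} (acc rs) p with dec (∃[ b ] (b < a × P b))
    ... | yes (b , q , r) = go (rs q) r
    ... | no none         = a , p , λ b q r → none (b , q , r)

  module _ {q} {Φ : Set → Set q} (up : ∀ {A B} → A ≼ B → Φ A → Φ B) where

    abstract
      -- Takes the shortest initial segment of A with the property, or A itself if there is none.
      -- That initial segments of the result fail Φ gives leastness through `compare`.
      leastCardinal : Φ A → Σ[ κ ∈ Set ] (Φ κ × Σ[ o ∈ WellOrder κ ] (∀ x → ¬ Φ (WellOrder.Below o x)))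
      leastCardinal {A} φ with dec (∃[ a ] Φ (WellOrder.Below (wellOrder A) a))
      ... | no none = A , φ , wellOrder A , λ x p → none (x , p)
      ... | yes e with minimal (wellOrder A) e
      ...   | a , φa , min = Below a , φa , pullback (Below≼ o a) o , smaller
        where
        o : WellOrder A
        o = wellOrder A
        open WellOrder o
        smaller : ∀ x → ¬ Φ (WellOrder.Below (pullback (Below≼ o a) o) x)
        smaller x@(b , [ p ]) φb = min b (recompute em p) (up (pullback-Below≼ (Below≼ o a) o x) φb)

    isLeast : ∀ {κ} → Φ κ → (o : WellOrder κ) → (∀ x → ¬ Φ (WellOrder.Below o x)) → IsLeast Φ κ
    isLeast {κ} φ o none = φ , below
      where
      below : ∀ μ → Φ μ → κ ≼ μ
      below μ ψ with compare o μ
      ... | inj₁ p       = p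
      ... | inj₂ (x , p) = contradiction (up p ψ) (none x)

  abstract
    cantor : ∀ A → ¬ ((A → Bool) ≼ A)
    cantor A f = ¬diag diag
      where
      Δ : A → Bool
      Δ a = ⟦ (∃[ p ] (to f p ≡ a × ¬ T (p a))) ⟧
      ¬diag : ¬ T (Δ (to f Δ))
      ¬diag t with toWitness t
      ... | p , eq , h with injective f eq
      ...   | refl = h t
      diag : T (Δ (to f Δ))
      diag = fromWitness (Δ , refl , ¬diag)

  abstract
    -- The least cardinal that does not embed in A; the power set is a candidate by Cantor's
    -- theorem. Minimality makes every initial segment embed in A.
    successor : ∀ A → Σ[ μ ∈ Set ] (IsSuccessor A μ × Σ[ o ∈ WellOrder μ ] (∀ x → WellOrder.Below o x ≼ A))
    successor A with leastCardinal up (cantor A)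
      where
      up : ∀ {B C} → B ≼ C → ¬ (B ≼ A) → ¬ (C ≼ A)
      up p h q = h (q ⊙ p)
    ... | μ , φ , o , small = μ , ((⋠⇒≽ φ , φ) , least) , o , λ x → byContradiction (small x)
      where
      least : ∀ ν → A ≺ ν → μ ≼ ν
      least ν (_ , h) = proj₂ (isLeast (λ p h q → h (q ⊙ p)) φ o small) ν h

  abstract
    ℕ⋠⇒Finite : ¬ (ℕ ≼ A) → Finite A
    ℕ⋠⇒Finite {A} h with compare ℕ-wellOrder A
    ... | inj₁ p       = contradiction p h
    ... | inj₂ (n , p) = n , mk↣ {to = λ (m , [ q ]) → fromℕ< q}
                               (λ eq → value-inj (fromℕ<-injective _ _ _ _ eq)) ⊙ p

  -- Absorption and squares of infinite sets.

  →-≼ : A ≼ B → (C → A) ≼ (C → B)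
  →-≼ f = mk↣ {to = to f ∘_} λ eq → funext λ c → injective f (cong (λ h → h c) eq)

  Fin→-Finite : ∀ {n} → Finite A → Finite (Fin n → A)
  Fin→-Finite {n = n} (m , f) = m ℕ.^ n ,
    mk↣ {to = funToFin} (λ {g} {h} eq → funext λ i →
      trans (sym (finToFun-funToFin g i)) (trans (cong (λ x → finToFun x i) eq) (finToFun-funToFin h i)))
    ⊙ →-≼ f

  abstract
    -- Hilbert's hotel: the copy of ℕ moves up by one place and `nothing` takes the free one.
    Maybe-absorb : ℕ ≼ A → Maybe A ≼ A
    Maybe-absorb {A} e = mk↣ {to = shift} (λ {x} {y} → shift-inj x y)
      where
      shift′ : ∀ a → Dec (∃[ n ] (to e n ≡ a)) → A
      shift′ a (yes (n , _)) = to e (suc n)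
      shift′ a (no _)        = a
      shift : Maybe A → A
      shift (just a) = shift′ a em
      shift nothing  = to e 0
      shift′-inj : ∀ {a b} d d′ → shift′ a d ≡ shift′ b d′ → a ≡ b
      shift′-inj (yes (m , p)) (yes (n , q)) eq =
        trans (sym p) (trans (cong (to e) (ℕ.suc-injective (injective e eq))) q)
      shift′-inj (yes (m , p)) (no h)        eq = contradiction (_ , eq) h
      shift′-inj (no h)        (yes (n , q)) eq = contradiction (_ , sym eq) h
      shift′-inj (no _)        (no _)        eq = eq
      shift′≢ : ∀ {a} d → shift′ a d ≢ to e 0
      shift′≢ (yes (n , p)) eq with injective e eq
      ... | ()
      shift′≢ (no h) eq = h (0 , sym eq)
      shift-inj : ∀ x y → shift x ≡ shift y → x ≡ y
      shift-inj (just a) (just b) eq = cong just (shift′-inj em em eq)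
      shift-inj (just a) nothing  eq = contradiction eq (shift′≢ em)
      shift-inj nothing  (just b) eq = contradiction (sym eq) (shift′≢ em)
      shift-inj nothing  nothing  eq = refl

  module _ {A : Set} (o : WellOrder A) where
    open WellOrder o

    _⊴_ : A → A → Set
    a ⊴ b = a < b ⊎ a ≡ b

    ⊴-trans : ∀ {a b c} → a ⊴ b → b ⊴ c → a ⊴ c
    ⊴-trans (inj₁ p)    (inj₁ q)    = inj₁ (trans< p q)
    ⊴-trans (inj₁ p)    (inj₂ refl) = inj₁ p
    ⊴-trans (inj₂ refl) q           = q

    ≮⇒⊵ : ∀ {a b} → ¬ (a < b) → b ⊴ a
    ≮⇒⊵ {a} {b} h with tri a b
    ... | inj₁ p           = contradiction p h
    ... | inj₂ (inj₁ refl) = inj₂ refl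
    ... | inj₂ (inj₂ p)    = inj₁ p

    max′ : ∀ a b → Dec (a < b) → ∃[ c ] (a ⊴ c × b ⊴ c)
    max′ a b (yes p) = b , inj₁ p , inj₂ refl
    max′ a b (no ¬p) = a , inj₂ refl , ≮⇒⊵ ¬p

    max : ∀ a b → ∃[ c ] (a ⊴ c × b ⊴ c)
    max a b = max′ a b em

    maximum : ∀ {n} (x : Fin (suc n) → A) → ∃[ j ] ∀ i → x i ⊴ x j
    maximum {zero}  x = Fin.zero , λ { Fin.zero → inj₂ refl }
    maximum {suc n} x with maximum (x ∘ Fin.suc)
    ... | j , above with dec (x Fin.zero < x (Fin.suc j))
    ...   | yes p = Fin.suc j , λ { Fin.zero → inj₁ p ; (Fin.suc i) → above i }
    ...   | no ¬p = Fin.zero , λ { Fin.zero → inj₂ refl ; (Fin.suc i) → ⊴-trans (above i) (≮⇒⊵ ¬p) }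

    squash′ : ∀ {a m} → Dec (a < m) → Maybe (Below m)
    squash′ {a} (yes p) = just (a , [ p ])
    squash′     (no _)  = nothing

    -- Codes the closed segment up to m, with `nothing` standing for m.
    squash : ∀ m → A → Maybe (Below m)
    squash m a = squash′ {a} em

    squash-injective : ∀ {m a b} → a ⊴ m → b ⊴ m → squash m a ≡ squash m b → a ≡ b
    squash-injective {m} {a} {b} a⊴ b⊴ = go em em
      where
      eq-top : ∀ {c} → c ⊴ m → ¬ (c < m) → c ≡ m
      eq-top (inj₁ p) ¬p = contradiction p ¬p
      eq-top (inj₂ q) _  = q
      go : ∀ d d′ → squash′ {a} {m} d ≡ squash′ {b} {m} d′ → a ≡ b
      go (yes _) (yes _) eq = cong value (just-injective eq)
      go (no p)  (no q)  eq = trans (eq-top a⊴ p) (sym (eq-top b⊴ q))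

  -- Gödel's ordering of pairs by their maximum.
  gödel : WellOrder A → WellOrder (A × A)
  gödel o = pullback (mk↣ {to = λ (a , b) → proj₁ (max o a b) , a , b} (cong proj₂)) (lex o (lex o o))

  -- Both entries of a pair that precedes x are at most the maximum m of x.
  gödel-segment : (o : WellOrder A) → ∀ x → ∃[ m ]
    WellOrder.Below (gödel o) x ≼ (Maybe (WellOrder.Below o m) × Maybe (WellOrder.Below o m))
  gödel-segment {A} o x@(c , d) = m , mk↣ {to = code} code-inj
    where
    open WellOrder o
    G = gödel o
    m = proj₁ (max o c d)
    ⊴m : ∀ {a b} → WellOrder._<_ G (a , b) x → _⊴_ o (proj₁ (max o a b)) m
    ⊴m (inj₁ p)       = inj₁ p
    ⊴m (inj₂ (p , _)) = inj₂ p
    code : WellOrder.Below G x → Maybe (Below m) × Maybe (Below m)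
    code ((a , b) , _) = squash o m a , squash o m b
    code-inj : Injective _≡_ _≡_ code
    code-inj {(a , b) , [ p ]} {(a′ , b′) , [ q ]} eq = value-inj (cong₂ _,_
      (squash-injective o (⊴-trans o (proj₁ ab) (⊴m p′)) (⊴-trans o (proj₁ ab′) (⊴m q′)) (cong proj₁ eq))
      (squash-injective o (⊴-trans o (proj₂ ab) (⊴m p′)) (⊴-trans o (proj₂ ab′) (⊴m q′)) (cong proj₂ eq)))
      where
      p′ = recompute em p
      q′ = recompute em q
      ab  = proj₂ (max o a b)
      ab′ = proj₂ (max o a′ b′)

  -- Otherwise A embeds in a segment of Gödel's order, hence in the square of a closed segment up to
  -- some m. This is finite, or embeds in `Below m` by the induction hypothesis; neither is large
  -- enough.
  square-step : (o : WellOrder A) → ℕ ≼ A → (∀ a → ¬ (A ≼ WellOrder.Below o a)) →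
                (∀ a → ℕ ≼ WellOrder.Below o a → Square (WellOrder.Below o a)) → Square A
  square-step {A} o inf big ih with compare (gödel o) A
  ... | inj₁ p = p
  ... | inj₂ (x , p) with gödel-segment o x
  ...   | m , q with dec (ℕ ≼ WellOrder.Below o m)
  ...     | yes i = contradiction (ih m i ⊙ ×-≼ (Maybe-absorb i) (Maybe-absorb i) ⊙ q ⊙ p) (big m)
  ...     | no ¬i = contradiction inf (ℕ⋠Finite (Finite-≼ (q ⊙ p) (×-Finite fin fin)))
    where
    fin = Maybe-Finite (ℕ⋠⇒Finite ¬i)

  abstract
    square : ℕ ≼ A → Square A
    square {A} inf = top em
      where
      o : WellOrder A
      o = wellOrder A
      open WellOrder o
      -- Either X embeds in an earlier segment, or no initial segment of its pulled-back order is as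
      -- large as X, which is what `square-step` asks for.
      segments : ∀ {a X} → Acc _<_ a → X ≼ Below a → ℕ ≼ X → Square X
      segments {a} {X} (acc rs) r i = go em
        where
        go : Dec (∃[ b ] (b < a × X ≼ Below b)) → Square X
        go (yes (b , b<a , s)) = segments (rs b<a) s i
        go (no h) = square-step (pullback r′ o) i
          (λ x s → h (to r′ x , lt x , pullback-Below≼ r′ o x ⊙ s))
          (λ x → segments (rs (lt x)) (pullback-Below≼ r′ o x))
          where
          r′ : X ≼ A
          r′ = Below≼ o a ⊙ r
          lt : ∀ x → to r′ x < a
          lt x with to r x
          ... | b , [ p ] = recompute em p
      top : Dec (∃[ a ] (A ≼ Below a)) → Square A
      top (yes (a , r)) = segments (wf a) r inf
      top (no h)        = square-step o inf (λ a r → h (a , r)) λ a → segments (wf a) (↣-id _)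

  -- The cardinality of ℝ.

  abstract
    powerset-≼ : A ≼ B → (A → Bool) ≼ (B → Bool)
    powerset-≼ {A} {B} f = mk↣ {to = image} λ {p} {q} eq → funext λ a →
      T-antisym (half eq a) (half (sym eq) a)
      where
      image : (A → Bool) → (B → Bool)
      image p b = ⟦ (∃[ a ] (to f a ≡ b × T (p a))) ⟧
      half : ∀ {p q} → image p ≡ image q → ∀ a → T (p a) → T (q a)
      half {q = q} eq a t with toWitness (subst (λ h → T (h (to f a))) eq (fromWitness (a , refl , t)))
      ... | c , p , u = subst (T ∘ q) (injective f p) u

  abstract
    ℚ≼ℕ : ℚ ≼ ℕ
    ℚ≼ℕ = square (↣-id _) ⊙ ×-≼ (square (↣-id _) ⊙ mk↣ {to = ℤ-code} ℤ-code-inj) (↣-id _) ⊙ mk↣ {to = ℚ-code} ℚ-code-inj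
      where
      ℤ-code : ℤ → ℕ × ℕ
      ℤ-code (+ n)    = 0 , n
      ℤ-code -[1+ n ] = 1 , n
      ℤ-code-inj : Injective _≡_ _≡_ ℤ-code
      ℤ-code-inj {+ _}      {+ _}      refl = refl
      ℤ-code-inj { -[1+ _ ]} { -[1+ _ ]} refl = refl
      ℚ-code : ℚ → ℤ × ℕ
      ℚ-code (mkℚ n d _) = n , d
      ℚ-code-inj : Injective _≡_ _≡_ ℚ-code
      ℚ-code-inj {mkℚ _ _ _} {mkℚ _ _ _} refl = refl

  abstract
    ℝ≼2^ℵ₀ : ℝ ≼ 2^ℵ₀
    ℝ≼2^ℵ₀ = powerset-≼ ℚ≼ℕ ⊙ mk↣ {to = ℝ.below} below-inj
      where
      below-inj : Injective _≡_ _≡_ ℝ.below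
      below-inj {mkℝ _ _ _ _ _} {mkℝ _ _ _ _ _} refl = refl

  abstract
    2^ℵ₀≼ℝ : 2^ℵ₀ ≼ ℝ
    2^ℵ₀≼ℝ = mk↣ {to = limit} limit-inj
      where
      unit : Interval
      unit = record { lo = 0ℚ ; hi = 1ℚ ; lo<hi = ℚ.positive⁻¹ 1ℚ }
      limit : 2^ℵ₀ → ℝ
      limit s = record
        { below     = λ q → ⟦ BelowLimit s unit q ⟧
        -- -½ lies below the first left end 0, and all left ends stay below 1.
        ; inhabited = -½ , fromWitness (0 , ℚ.negative⁻¹ -½)
        ; proper    = 1ℚ , λ t → let n , p = toWitness t in ℚ.<-asym p (lower<hi s unit n)
        ; downward  = λ q<r t → let n , p = toWitness t in fromWitness (n , ℚ.<-trans q<r p)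
        ; open-up   = λ t → let n , p = toWitness t ; m , q , r = ℚ.<-dense p in m , q , fromWitness (n , r)
        }
      half : ∀ {s t} → limit s ≡ limit t → ∀ q → BelowLimit s unit q → BelowLimit t unit q
      half eq q p = toWitness (subst (λ x → T (ℝ.below x q)) eq (fromWitness p))
      limit-inj : Injective _≡_ _≡_ limit
      limit-inj eq = funext λ n → limit-injective n unit (half eq) (half (sym eq))

  -- Iterated successors and the continuum.

  iteratedSuccessor : ∀ n κ → ∃[ μ ] IsIteratedSuccessor n κ μ
  iteratedSuccessor zero    κ = κ , lift (↔-id κ)
  iteratedSuccessor (suc n) κ =
    let ν , p     = iteratedSuccessor n κ
        μ , q , _ = successor ν
    in μ , ν , p , q

  iteratedSuccessor-mono : ∀ n {κ κ′ μ} → κ ≼ κ′ → IsIteratedSuccessor n κ μ →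
                           ∃[ μ′ ] (IsIteratedSuccessor n κ′ μ′ × μ ≼ μ′)
  iteratedSuccessor-mono zero {κ′ = κ′} f (lift e) = κ′ , lift (↔-id κ′) , f ⊙ ↔⇒↣ (↔-sym e)
  iteratedSuccessor-mono (suc n) f (ν , p , _ , least) with iteratedSuccessor-mono n f p
  ... | ν′ , p′ , g with successor ν′
  ...   | μ′ , s@((ν′≼μ′ , μ′⋠ν′) , _) , _ =
    μ′ , (ν′ , p′ , s) , least μ′ (ν′≼μ′ ⊙ g , λ h → μ′⋠ν′ (g ⊙ h))

  iteratedSuccessor-Finite : ∀ n {κ μ} → IsIteratedSuccessor n κ μ → Finite κ → Finite μ
  iteratedSuccessor-Finite zero    (lift e) fin = Finite-≼ (↔⇒↣ (↔-sym e)) fin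
  iteratedSuccessor-Finite (suc n) (ν , p , _ , least) fin =
    let m , f = iteratedSuccessor-Finite n p fin
        ¬g    = λ g → Fin⋠Fin (ℕ.n<1+n m) (f ⊙ g)
    in suc m , least (Fin (suc m)) (⋠⇒≽ ¬g , ¬g)

  ℕ≼2^ℵ₀ : ℕ ≼ 2^ℵ₀
  ℕ≼2^ℵ₀ = ⋠⇒≽ (cantor ℕ)

  ReachesContinuum-mono : ∀ n {κ κ′} → κ ≼ κ′ → ReachesContinuum n κ → ReachesContinuum n κ′
  ReachesContinuum-mono n f (μ , p , g) =
    let μ′ , p′ , h = iteratedSuccessor-mono n f p in μ′ , p′ , h ⊙ g

  -- A finite cardinal has only finite iterated successors.
  ReachesContinuum⇒infinite : ∀ n {κ} → ReachesContinuum n κ → ℕ ≼ κ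
  ReachesContinuum⇒infinite n (μ , p , g) = byContradiction λ h →
    ℕ⋠Finite (iteratedSuccessor-Finite n p (ℕ⋠⇒Finite h)) (g ⊙ ℕ≼2^ℵ₀)

  Fin→-absorb : ∀ n → ℕ ≼ A → (Fin n → A) ≼ A
  Fin→-absorb zero    e = mk↣ {to = λ _ → to e 0} λ _ → funext λ ()
  Fin→-absorb (suc n) e = square e ⊙ ×-≼ (↣-id _) (Fin→-absorb n e) ⊙
    mk↣ {to = λ f → f Fin.zero , f ∘ Fin.suc} λ eq → funext λ
      { Fin.zero    → cong proj₁ eq
      ; (Fin.suc i) → cong (λ p → proj₂ p i) eq }

  -- Colourings with determining coordinates.

  -- `sel` assigns to every colour m coordinates which determine the points of
  -- that colour.
  DeterminingColouring : ℕ → ℕ → Set → Set → Set₁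
  DeterminingColouring m d X κ =
    Σ[ C ∈ Set ] (C ≼ κ × Σ[ col ∈ ((Fin d → X) → C) ] Σ[ sel ∈ (C → Fin m → Fin d) ]
      (∀ x y → col x ≡ col y → (∀ i → x (sel (col x) i) ≡ y (sel (col x) i)) → x ≡ y))

  -- For the step, fix the largest coordinate t of a point: the other
  -- coordinates lie in the initial segment of t, which embeds into ν.
  determiningColouring : ∀ m d {κ μ} → ℕ ≼ κ → IsIteratedSuccessor m κ μ →
                         DeterminingColouring m (suc d) μ κ
  determiningColouring zero d {κ} inf (lift e) =
    -- With m = 0 the colour alone must determine the point, so all tuples are embedded in κ.
    κ , ↣-id κ , to f , (λ _ ()) , λ x y p _ → injective f p
    where
    f = Fin→-absorb (suc d) inf ⊙ →-≼ (↔⇒↣ (↔-sym e))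
  determiningColouring (suc m) d {κ} {μ} inf (ν , p , s)
    with determiningColouring m d inf p | successor ν
  ... | C , C≼κ , col , sel , det | μ′ , s′ , o , small =
    (Fin (suc d) × C) , square inf ⊙ ×-≼ (inf ⊙ Fin≼ℕ) C≼κ , col′ , sel′ , det′
    where
    -- Leastness embeds `μ` in `μ′`, whose well-order has initial segments that embed in `ν`.
    r : μ ≼ μ′
    r = proj₂ s μ′ (proj₁ s′)
    ν-inf : ℕ ≼ ν
    ν-inf = iteratedSuccessor-≽ m p ⊙ inf
    absorb : ∀ t → Maybe (WellOrder.Below o t) ≼ ν
    absorb t = Maybe-absorb ν-inf ⊙ Maybe-≼ (small t)
    ι : μ → μ → ν
    ι t a = to (absorb (to r t)) (squash o (to r t) (to r a))
    top : ∀ x → ∃[ j ] ∀ i → _⊴_ o (to r (x i)) (to r (x j))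
    top x = maximum o (to r ∘ x)
    topmost : (Fin (suc d) → μ) → μ
    topmost x = x (proj₁ (top x))
    col′ : (Fin (suc d) → μ) → Fin (suc d) × C
    col′ x = proj₁ (top x) , col (ι (topmost x) ∘ x)
    sel′ : Fin (suc d) × C → Fin (suc m) → Fin (suc d)
    sel′ (j , c) Fin.zero    = j
    sel′ (j , c) (Fin.suc i) = sel c i
    det′ : ∀ x y → col′ x ≡ col′ y → (∀ i → x (sel′ (col′ x) i) ≡ y (sel′ (col′ x) i)) → x ≡ y
    det′ x y eq agree = funext λ i → injective r (squash-injective o (proj₂ (top x) i)
      (subst (λ t → _⊴_ o (to r (y i)) (to r t)) (sym same) (proj₂ (top y) i))
      (injective (absorb _) (cong (λ f → f i) low)))
      where
      -- The colour records the position of the maximum and `sel′` selects it, so both points are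
      -- coded below the same bound.
      same : topmost x ≡ topmost y
      same = trans (agree Fin.zero) (cong y (cong proj₁ eq))
      low : ι (topmost x) ∘ x ≡ ι (topmost x) ∘ y
      low = det _ _ (trans (cong proj₂ eq) (cong (λ t → col (ι t ∘ y)) (sym same)))
        λ i → cong (ι (topmost x)) (agree (Fin.suc i))

  -- The upper bound.

  injective⇒surjective : ∀ {n} {f : Fin n → Fin n} → Injective _≡_ _≡_ f → ∀ y → ∃[ x ] f x ≡ y
  injective⇒surjective {suc n} {f} inj y = byContradiction λ none →
    let y≢ = λ x eq → none (x , sym eq) in
    Fin⋠Fin (ℕ.n<1+n n) (mk↣ {to = λ x → punchOut {i = y} (y≢ x)}
      λ {u} {v} eq → inj (punchOut-injective (y≢ u) (y≢ v) eq))

  surjective⇒injective : ∀ {n} {f : Fin n → Fin n} → (∀ y → ∃[ x ] f x ≡ y) → Injective _≡_ _≡_ f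
  surjective⇒injective {f = f} surj {x} {y} eq =
    let u , p = onto x ; v , q = onto y
        u≡v = trans (sym (proj₂ (surj u))) (trans (cong f p) (trans eq (trans (cong f (sym q)) (proj₂ (surj v)))))
    in trans (sym p) (trans (cong (proj₁ ∘ surj) u≡v) q)
    where
    onto = injective⇒surjective {f = proj₁ ∘ surj} λ {u} {v} p →
      trans (sym (proj₂ (surj u))) (trans (cong f p) (proj₂ (surj v)))

  -- A surjection between sets of the same finite size is injective; the enumerations reduce this to
  -- a self-map of `Fin k`.
  image-injective : ∀ {a b p q k} {A : Set a} {B : Set b} {P : Pred A p} {Q : Pred B q} →
    HasSize P k → HasSize Q k → (f : Σ A P → Σ B Q) →
    (∀ s t → proj₁ s ≡ proj₁ t → proj₁ (f s) ≡ proj₁ (f t)) →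
    (∀ t → Q t → ∃[ s ] proj₁ (f s) ≡ t) →
    ∀ s t → proj₁ (f s) ≡ proj₁ (f t) → proj₁ s ≡ proj₁ t
  image-injective {k = k} {P = P} {Q} (x , _ , x∈) (y , y-inj , y∈) f resp surj s t eq =
    trans (sym (proj₂ (index s))) (trans (cong x same) (proj₂ (index t)))
    where
    index : ∀ s → ∃[ j ] x j ≡ proj₁ s
    index s = Equivalence.to (x∈ (proj₁ s)) (proj₂ s)
    point : Fin k → Σ _ P
    point j = x j , Equivalence.from (x∈ (x j)) (j , refl)
    φ : ∀ j → ∃[ i ] y i ≡ proj₁ (f (point j))
    φ j = Equivalence.to (y∈ _) (proj₂ (f (point j)))
    φ-of : ∀ s → y (proj₁ (φ (proj₁ (index s)))) ≡ proj₁ (f s)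
    φ-of s = trans (proj₂ (φ _)) (resp _ _ (proj₂ (index s)))
    φ-surj : ∀ i → ∃[ j ] proj₁ (φ j) ≡ i
    φ-surj i = let s , p = surj (y i) (Equivalence.from (y∈ (y i)) (i , refl)) in
      proj₁ (index s) , y-inj (trans (φ-of s) p)
    same : proj₁ (index s) ≡ proj₁ (index t)
    same = surjective⇒injective {f = proj₁ ∘ φ} φ-surj
      (y-inj (trans (φ-of s) (trans eq (sym (φ-of t)))))

  -- Points of P that agree on the coordinates selected by the colour of a monochromatic edge have
  -- equal images, hence are equal. These at most m coordinates would thus distinguish P.
  colorable : ∀ {y p m d k κ} {Y : Fin (suc d) → Set y} (P : Template Y (suc k) p) →
              (∀ I → IsDistinguisher P I → suc m ≤ ∣ I ∣) →
              ReachesContinuum m κ → Colorable (L (λ _ → ℝ) P) κ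
  colorable {m = m} {d} {κ = κ} P large reach@(μ , it , 2^ℵ₀≼μ)
    with determiningColouring m d (ReachesContinuum⇒infinite m reach) it
  ... | C , C≼κ , col , sel , det = to C≼κ ∘ col′ , proper
    where
    ε : ℝ ≼ μ
    ε = 2^ℵ₀≼μ ⊙ ℝ≼2^ℵ₀
    col′ : (Fin (suc d) → ℝ) → C
    col′ x = col (to ε ∘ x)
    proper : IsProperColoring (L (λ _ → ℝ) P) (to C≼κ ∘ col′)
    proper Q (sizeQ@(z , _ , z∈) , f , surj , coord) mono =
      ℕ.<⇒≱ (large S distinguishes) ∣S∣≤m
      where
      -- An edge has a first point, whose colour is the common one.
      Sdata = range (sel (col′ (z Fin.zero)))
      S = proj₁ Sdata
      ∣S∣≤m = proj₁ (proj₂ Sdata)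
      col≡ : ∀ u v → Q u → Q v → col′ u ≡ col′ v
      col≡ u v Qu Qv = injective C≼κ (mono u v Qu Qv)
      distinguishes : IsDistinguisher P S
      distinguishes s t Ps Pt s≢t = byContradiction λ none → s≢t
        (image-injective (size P) sizeQ f (λ s t eq → funext λ i → coord s t i (cong (λ h → h i) eq)) surj
          (s , Ps) (t , Pt) (funext λ i → injective ε (cong (λ h → h i) (image≡ none))))
        where
        fs = f (s , Ps)
        ft = f (t , Pt)
        image≡ : ¬ (∃[ i ] (i ∈ₛ S × s i ≢ t i)) → to ε ∘ proj₁ fs ≡ to ε ∘ proj₁ ft
        image≡ none = det _ _ (col≡ _ _ (proj₂ fs) (proj₂ ft)) λ i →
          cong (to ε) (coord _ _ _ (byContradiction λ s≢ →
            none (_ , subst (λ c → sel c i ∈ₛ S)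
              (col≡ _ _ (Equivalence.from (z∈ _) (Fin.zero , refl)) (proj₂ fs))
              (proj₂ (proj₂ Sdata) i) , s≢)))

  -- Monochromatic boxes.

  -- If no fibre contains k points, comparability embeds every fibre in `Fin k`, and so X in the
  -- product.
  pigeonhole : ∀ {k X Z} → ¬ (X ≼ (Z × Fin k)) → (h : X → Z) →
               ∃[ z ] Σ[ e ∈ (Fin k ≼ X) ] (∀ j → h (to e j) ≡ z)
  pigeonhole {k} {X} {Z} X⋠ h = byContradiction λ none → X⋠ (embedding none)
    where
    Fibre : Z → Set
    Fibre z = Refinement X λ x → h x ≡ z
    module _ (none : ¬ (∃[ z ] Σ[ e ∈ (Fin k ≼ X) ] (∀ j → h (to e j) ≡ z))) where
      small : ∀ z → Fibre z ≼ Fin k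
      small z = ⋠⇒≽ λ e → none (z , mk↣ value-inj ⊙ e , λ j → in-fibre (to e j))
        where
        in-fibre : ∀ (x : Fibre z) → h (value x) ≡ z
        in-fibre (x , [ p ]) = recompute em p
      same-fibre : ∀ {x y z z′} → z ≡ z′ → (p : h x ≡ z) (q : h y ≡ z′) →
                   to (small z) (x , [ p ]) ≡ to (small z′) (y , [ q ]) → x ≡ y
      same-fibre {z = z} refl p q eq = cong value (injective (small z) eq)
      embedding : X ≼ (Z × Fin k)
      embedding = mk↣ {to = λ x → h x , to (small (h x)) (x , [ refl ])} λ eq →
        same-fibre (cong proj₁ eq) refl refl (cong proj₂ eq)

  HasBoxes-zero : ∀ {k K X} → HasBoxes k 0 K X
  HasBoxes-zero f = (λ ()) , (λ ()) , λ g h → cong f (funext λ ())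

  -- Each x in X yields a monochromatic box for its section. X is too large for the pairs of a box
  -- and a colour, so `suc k` values of x share a pair; they form the new side.
  HasBoxes-suc : ∀ {k n K V X} → HasBoxes (suc k) n K V → V ≼ X →
                 ¬ (X ≼ (((Fin n → Fin (suc k) → V) × K) × Fin (suc k))) →
                 HasBoxes (suc k) (suc n) K X
  HasBoxes-suc {k} {n} {K} {V} {X} box ι X⋠ f =
    let (B , c) , e , same = pigeonhole X⋠ boxOf
        a = to e Fin.zero
        B≡ : ∀ j → proj₁ (sect (to e j)) ≡ B
        B≡ j = cong proj₁ (same j)
        const : ∀ (g : Fin (suc n) → Fin (suc k)) → f (to e (g Fin.zero) ◂ λ i → to ι (B i (g (Fin.suc i)))) ≡ c
        const g = trans
          (cong (λ B → f (to e (g Fin.zero) ◂ λ i → to ι (B i (g (Fin.suc i))))) (sym (B≡ (g Fin.zero))))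
          (trans (proj₂ (proj₂ (sect (to e (g Fin.zero)))) _ _) (cong proj₂ (same (g Fin.zero))))
        box-row : ∀ g → (λ i → (to e ◂ λ i → to ι ∘ B i) i (g i)) ≡ (to e (g Fin.zero) ◂ λ i → to ι (B i (g (Fin.suc i))))
        box-row g = funext λ { Fin.zero → refl ; (Fin.suc i) → refl }
        total : ∀ g → f (λ i → (to e ◂ λ i → to ι ∘ B i) i (g i)) ≡ c
        total g = trans (cong f (box-row g)) (const g)
    in (to e ◂ λ i → to ι ∘ B i)
     , (λ { Fin.zero → injective e
          ; (Fin.suc i) eq → subst (λ B → ∀ i → Injective _≡_ _≡_ (B i)) (B≡ Fin.zero)
              (proj₁ (proj₂ (sect a))) i (injective ι eq) })
     , λ g h → trans (total g) (sym (total h))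
    where
    section : X → (Fin n → V) → K
    section x v = f (x ◂ to ι ∘ v)
    sect : ∀ x → _
    sect x = box (section x)
    boxOf : X → (Fin n → Fin (suc k) → V) × K
    -- The section is constant on its box, so the colour is read at one corner.
    boxOf x = proj₁ (sect x) , section x (λ i → proj₁ (sect x) i Fin.zero)

  -- The boxes in V, the colours and the indices together embed in V, while its successor X does
  -- not.
  HasBoxes-infinite : ∀ {k K} n {X} → ℕ ≼ K → IsIteratedSuccessor n K X → HasBoxes (suc k) n K X
  HasBoxes-infinite zero inf _ = HasBoxes-zero
  HasBoxes-infinite {k} {K} (suc n) {X} inf (V , p , (V≼X , X⋠V) , _) =
    HasBoxes-suc (HasBoxes-infinite n inf p) V≼X (λ e → X⋠V (small ⊙ e))
    where
    K≼V = iteratedSuccessor-≽ n p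
    V-inf : ℕ ≼ V
    V-inf = K≼V ⊙ inf
    small : (((Fin n → Fin (suc k) → V) × K) × Fin (suc k)) ≼ V
    small = square V-inf ⊙ ×-≼ (square V-inf ⊙
      ×-≼ (Fin→-absorb n V-inf ⊙ →-≼ (Fin→-absorb (suc k) V-inf)) K≼V) (V-inf ⊙ Fin≼ℕ)

  HasBoxes-finite : ∀ {k K} n → Finite K → ∃[ N ] HasBoxes (suc k) n K (Fin N)
  HasBoxes-finite zero _ = 0 , HasBoxes-zero
  HasBoxes-finite {k} (suc n) fin =
    let N , box = HasBoxes-finite n fin
        M , e   = ×-Finite (×-Finite (Fin→-Finite (Fin→-Finite (Fin-Finite N))) fin) (Fin-Finite (suc k))
    -- The summand N makes room for `Fin N`; `suc M` exceeds the bound for the pigeonhole principle.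
    in suc M ℕ.+ N , HasBoxes-suc box (mk↣ {to = suc M ↑ʳ_} (↑ʳ-injective (suc M) _ _))
         λ h → Fin⋠Fin (ℕ.m≤m+n (suc M) N) (e ⊙ h)

  HasBoxes-ℝ : ∀ {k m K} → ¬ ReachesContinuum m K → HasBoxes (suc k) (suc m) K ℝ
  HasBoxes-ℝ {m = m} {K} h with dec (ℕ ≼ K)
  ... | no ¬inf =
    let N , box = HasBoxes-finite (suc m) (ℕ⋠⇒Finite ¬inf)
    in HasBoxes-mono (2^ℵ₀≼ℝ ⊙ ℕ≼2^ℵ₀ ⊙ Fin≼ℕ) box
  ... | yes inf =
    let μ , p     = iteratedSuccessor m K
        X , s , _ = successor μ
        2^ℵ₀⋠μ    = λ e → h (μ , p , e)
    in HasBoxes-mono (2^ℵ₀≼ℝ ⊙ proj₂ s 2^ℵ₀ (⋠⇒≽ 2^ℵ₀⋠μ , 2^ℵ₀⋠μ))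
         (HasBoxes-infinite (suc m) inf (μ , p , s))

  -- The lower bound.

  -- Each point of P goes to the point of the box indexed by the labels of its coordinates in I.
  -- Equal coordinates have equal labels, and I keeps distinct points apart, so the image is a
  -- monochromatic edge.
  reachesContinuum : ∀ {y p d m k κ} {Y : Fin d → Set y} (P : Template Y (suc k) p) I →
                     IsDistinguisher P I → ∣ I ∣ ≡ suc m →
                     Colorable (L (λ _ → ℝ) P) κ → ReachesContinuum m κ
  reachesContinuum {d = d} {m} {k} {κ} {Y} P I dist ∣I∣≡ (col , proper) =
    byContradiction λ h → monochromatic (HasBoxes-ℝ h)
    where
    pt     = proj₁ (size P)
    pt-inj = proj₁ (proj₂ (size P))
    pt∈    = proj₂ (proj₂ (size P))

    Labelled : ∀ i → Y i → Set _
    Labelled i v = ∃[ j ] pt j i ≡ v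

    label′ : ∀ {i v} → Dec (Labelled i v) → Fin (suc k)
    label′ (yes (j , _)) = j
    label′ (no _)        = Fin.zero

    -- A function of the value v alone, so that equal coordinates get equal labels.
    label : ∀ i → Y i → Fin (suc k)
    label i v = label′ {i} {v} em

    pt-label : ∀ {s} → points P s → ∀ i → pt (label i (s i)) i ≡ s i
    pt-label {s} Ps i = go em
      where
      go : ∀ d → pt (label′ {i} {s i} d) i ≡ s i
      go (yes (_ , p)) = p
      go (no none)     = let j , p = Equivalence.to (pt∈ s) Ps in
        contradiction (j , cong (λ h → h i) p) none

    emb = proj₁ (enumerate I)

    vertex′ : ∀ {i} → (Fin ∣ I ∣ → ℝ) → Dec (∃[ j ] emb j ≡ i) → ℝ
    vertex′ x (yes (j , _)) = x j
    -- Coordinates without an axis receive one fixed real, so that images agree there.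
    vertex′ x (no _)        = to 2^ℵ₀≼ℝ λ _ → false

    vertex : (Fin ∣ I ∣ → ℝ) → Fin d → ℝ
    vertex x i = vertex′ {i} x em

    monochromatic : ¬ HasBoxes (suc k) (suc m) κ ℝ
    monochromatic boxes = proper Q ((f ∘ pt , pt-inj ∘ f-inj _ _ (Ppt _) (Ppt _) , λ z → mk⇔ id id) , image , f-surj , f-coord)
      λ { s t (i , p) (j , q) → trans (cong col (sym p)) (trans (proj₂ (proj₂ box) _ _) (cong col q)) }
      where
      box = subst (λ n → HasBoxes (suc k) n κ ℝ) (sym ∣I∣≡) boxes (col ∘ vertex)
      corner = proj₁ box
      row : (∀ i → Y i) → Fin ∣ I ∣ → ℝ
      row t j = corner j (label (emb j) (t (emb j)))
      f : (∀ i → Y i) → Fin d → ℝ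
      f t = vertex (row t)
      Q : (Fin d → ℝ) → Set
      Q z = ∃[ j ] f (pt j) ≡ z
      Ppt : ∀ j → points P (pt j)
      Ppt j = Equivalence.from (pt∈ (pt j)) (j , refl)
      image : Σ _ (points P) → Σ _ Q
      image (t , Pt) = f t , let j , p = Equivalence.to (pt∈ t) Pt in j , cong f p
      f-surj : ∀ z → Q z → ∃[ s ] proj₁ (image s) ≡ z
      f-surj z (j , p) = (pt j , Ppt j) , p
      f-coord : ∀ s t i → proj₁ s i ≡ proj₁ t i → f (proj₁ s) i ≡ f (proj₁ t) i
      f-coord (s , _) (t , _) i p = go em
        where
        go : ∀ d → vertex′ {i} (row s) d ≡ vertex′ {i} (row t) d
        go (yes (j , refl)) = cong (corner j ∘ label (emb j)) p
        go (no _)           = refl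
      f-inj : ∀ s t → points P s → points P t → f s ≡ f t → s ≡ t
      f-inj s t Ps Pt eq = byContradiction λ s≢t →
        let i , i∈I , si≢ti = dist s t Ps Pt s≢t
        in si≢ti (coord i∈I)
        where
        coord : ∀ {i} → i ∈ₛ I → s i ≡ t i
        coord {i} i∈I = go em (cong (λ h → h i) eq)
          where
          go : ∀ d → vertex′ {i} (row s) d ≡ vertex′ {i} (row t) d → s i ≡ t i
          go (no none)        _ = contradiction (proj₂ (enumerate I) i∈I) none
          go (yes (j , refl)) q = trans (sym (pt-label Ps (emb j)))
            (trans (cong (λ l → pt l (emb j)) (proj₁ (proj₂ box) j q)) (pt-label Pt (emb j)))

  -- The value e(P) and the conclusion.

  isₑ : ∀ {y p d k} {Y : Fin d → Set y} (P : Template Y k p) → ∃[ e ] Isₑ P e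
  isₑ {d = d} P with minimal ℕ-wellOrder {P = λ n → ∃[ I ] (IsDistinguisher P I × ∣ I ∣ ≡ n)}
    -- The set of all coordinates starts the search for a least distinguisher.
    (∣ Subset.⊤ {d} ∣ , Subset.⊤ , all , refl)
    where
    all : IsDistinguisher P Subset.⊤
    all s t _ _ s≢t = let i , p = ¬∀⇒∃¬ (λ h → s≢t (funext h)) in i , ∈⊤ , p
  ... | e , I , min = e , I , λ J dist → ℕ.≮⇒≥ λ lt → min ∣ J ∣ lt (J , dist , refl)

  -- Two distinct points of P force a coordinate into every distinguisher; hence `e ∸ 1` is a true
  -- predecessor.
  e≢0 : ∀ {y p d k} {Y : Fin d → Set y} (P : Template Y (2 ℕ.+ k) p) → ¬ Isₑ P 0
  e≢0 {k = k} P ((I , dist , ∣I∣≡0) , _) =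
    let pt , inj , pt∈ = size P
        member = λ j → Equivalence.from (pt∈ (pt j)) (j , refl)
        i , i∈I , _ = dist (pt Fin.zero) (pt (Fin.suc Fin.zero)) (member _) (member _) (λ eq → 0≢1+n (inj eq))
        j , _ = proj₂ (enumerate I) i∈I
    in ¬Fin0 (subst Fin ∣I∣≡0 j)

theorem1p1 : Classical →
    {y p : Level} (d k : ℕ) → 1 ≤ d → 2 ≤ k →
    (Y : Fin d → Set y) (P : Template Y k p) →
    ∃[ e ] (Isₑ P e ×
    (Σ[ κ ∈ Cardinal ]
    (IsChromaticNumber (L (λ (_ : Fin d) → ℝ) P) κ ×
    IsLeast (ReachesContinuum (e ∸ 1)) κ)))
theorem1p1 cl (suc d) (suc (suc k)) _ (ℕ.s≤s (ℕ.s≤s _)) Y P with isₑ cl P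
... | zero  , isE = contradiction isE (e≢0 cl P)
... | suc m , isE@((I , dist , ∣I∣≡) , large)
  -- The continuum itself reaches the continuum, so a least such cardinal exists.
  with leastCardinal cl (ReachesContinuum-mono cl m)
         (let μ , p = iteratedSuccessor cl m 2^ℵ₀ in μ , p , iteratedSuccessor-≽ m p)
...   | κ , reach , o , small = suc m , isE , κ ,
  -- Any number of colours that suffices reaches the continuum, so leastness carries over to the
  -- chromatic number.
  (colorable cl P large reach , λ μ c → proj₂ least μ (reachesContinuum cl P I dist ∣I∣≡ c)) , least
  where
  least : IsLeast (ReachesContinuum m) κ
  least = isLeast cl (ReachesContinuum-mono cl m) reach o small
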